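{- Fix $n\ge0$, a formula $\phi\in\mathcal{L}^1$ and a label $w$. (i) If $\mathtt{Prove_n}(w:\phi)$ returns true, then $w:\phi$ is derivable in $\mathsf{Ldm}_{n}^{1}\mathsf{L}$. (ii) If $\mathtt{Prove_n}(w:\phi)$ returns false, then $w:\phi$ is not derivable in $\mathsf{Ldm}_{n}^{1}\mathsf{L}$.
   Context: Single-agent setting: $Ag=\{1\}$. Formulas $\phi ::= p \mid \overline{p} \mid (\phi\wedge\phi) \mid (\phi\vee\phi) \mid \Box\phi \mid \Diamond\phi \mid [1]\phi \mid \langle 1\rangle\phi$; $\overline{\phi}$ swaps $p/\overline{p}$, $\wedge/\vee$, $\Box/\Diamond$, $[1]/\langle 1\rangle$. A labelled sequent $\mathcal{R},\Gamma$ consists of a multiset $\mathcal{R}$ of relational atoms $\mathcal{R}_1xy$ and a multiset $\Gamma$ of labelled formulas $x:\phi$. Calculus $\mathsf{Ldm}_{n}^{1}\mathsf{L}$ (premise(s) / conclusion; derivations are finite trees with $(\mathsf{id})$ leaves): $(\mathsf{id})$: / $\mathcal{R}, w:p, w:\overline{p},\Gamma$. $(\wedge)$: $\mathcal{R}, w:\phi\wedge\psi, w:\phi,\Gamma$ and $\mathcal{R}, w:\phi\wedge\psi, w:\psi,\Gamma$ / $\mathcal{R}, w:\phi\wedge\psi,\Gamma$. $(\vee)$: $\mathcal{R}, w:\phi\vee\psi, w:\phi, w:\psi,\Gamma$ / $\mathcal{R}, w:\phi\vee\psi,\Gamma$. $(\Box)$: $\mathcal{R}, w:\Box\phi, v:\phi,\Gamma$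 / $\mathcal{R}, w:\Box\phi,\Gamma$ ($v$ fresh). $(\Diamond)$: $\mathcal{R}, w:\Diamond\phi, u:\phi,\Gamma$ / $\mathcal{R}, w:\Diamond\phi,\Gamma$. $(\mathsf{IOA})$: $\mathcal{R},\mathcal{R}_1uv,\Gamma$ / $\mathcal{R},\Gamma$ ($v$ fresh). $([1])$: $\mathcal{R},\mathcal{R}_1wv, w:[1]\phi, v:\phi,\Gamma$ / $\mathcal{R}, w:[1]\phi,\Gamma$ ($v$ fresh). $(\mathsf{Pr}_1)$: $\mathcal{R}, w:\langle 1\rangle\phi, u:\phi,\Gamma$ / $\mathcal{R}, w:\langle 1\rangle\phi,\Gamma$, applicable only if $w=u$ or there are labels $w=z_0,\dots,z_k=u$ ($k\ge1$) with $\mathcal{R}_1z_lz_{l+1}\in\mathcal{R}$ or $\mathcal{R}_1z_{l+1}z_l\in\mathcal{R}$ for each $l<k$. $(\mathsf{APC}^1_n)$ (only if $n>0$): premises $\mathcal{R},\mathcal{R}_1w_kw_j,\Gamma$ for all $0\le k\le n-1$, $k+1\le j\le n$ / $\mathcal{R},\Gamma$. "Fresh" means not occurring in the conclusion. Graphs. $G(\Lambda)$ has the labels of $\Lambda$ as vertices and an edge $(x,y)$ for each $\mathcal{R}_1xy\in\Lambda$. A tree is a graph with a root having exactly one directed path to every other node; a forest is a disjoint union of trees. $\Lambda$ is forestlike iff $G(\Lambda)$ is a forest; its trees are choice-trees; $CT(w)$ is the choice-tree containing $w$. For forestlike $\Lambda$ and label $w$: $w$ is saturated iff (i) $w:\phi\in\Lambda$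 implies $w:\overline{\phi}\notin\Lambda$, (ii) $w:\phi\vee\psi\in\Lambda$ implies $w:\phi,w:\psi\in\Lambda$, (iii) $w:\phi\wedge\psi\in\Lambda$ implies $w:\phi\in\Lambda$ or $w:\psi\in\Lambda$. $w$ is $\Box$-realized iff for each $w:\Box\phi\in\Lambda$ some label $u$ has $u:\phi\in\Lambda$; $[1]$-realized iff for each $w:[1]\phi\in\Lambda$ some $u\in CT(w)$ has $u:\phi\in\Lambda$; $\Diamond$-propagated iff for each $w:\Diamond\phi\in\Lambda$, $u:\phi\in\Lambda$ for all labels $u$; $\langle1\rangle$-propagated iff for each $w:\langle1\rangle\phi\in\Lambda$, $u:\phi\in\Lambda$ for all $u\in CT(w)$. $\Lambda$ is $n$-choice consistent ($n>0$) iff $G(\Lambda)$ has at most $n$ choice-trees. $\Lambda$ is stable iff all labels are saturated, $\Box$- and $[1]$-realized, $\Diamond$- and $\langle1\rangle$-propagated, and (when $n>0$) $\Lambda$ is $n$-choice consistent. Algorithm $\mathtt{Prove_n}(\mathcal{R},\Gamma)$, steps tried in order: 1. If $w:p$ and $w:\overline{p}$ are both present, return true. 2. If the sequent is stable, return false. 3. If some $w$ is not saturated: (i) if $w:\phi\vee\psi$ is present but $w:\phi$ or $w:\psi$ absent, return $\mathtt{Prove_n}(\mathcal{R},w:\phi,w:\psi,\Gamma)$; (ii) if $w:\phi\wedge\psi$ is present but neither $w:\phi$ nor $w:\psi$, return false if $\mathtt{Prove_n}(\mathcal{R},w:\phi,\Gamma)$ or $\mathtt{Prove_n}(\mathcal{R},w:\psi,\Gamma)$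 returns false, else true. 4. If some $w:\langle1\rangle\phi$ is present and some $u\in CT(w)$ has $u:\phi$ absent, return $\mathtt{Prove_n}(\mathcal{R},u:\phi,\Gamma)$. 5. If some $w:\Diamond\phi$ is present and some label $u$ has $u:\phi$ absent, return $\mathtt{Prove_n}(\mathcal{R},u:\phi,\Gamma)$. 6. If some $w:[1]\phi$ is present with $u:\phi$ absent for all $u\in CT(w)$, return $\mathtt{Prove_n}(\mathcal{R},\mathcal{R}_1wv,v:\phi,\Gamma)$, $v$ fresh. 7. If some $w:\Box\phi$ is present with $u:\phi$ absent for all labels $u$, return $\mathtt{Prove_n}(\mathcal{R},v:\phi,\Gamma)$, $v$ fresh. 8. (Only when $n>0$.) If not $n$-choice consistent, pick distinct choice-tree roots $w_0,\dots,w_n$ and return false if $\mathtt{Prove_n}(\mathcal{R},\mathcal{R}_1w_kw_j,\Gamma)$ returns false for some $0\le k\le n-1$, $k+1\le j\le n$, else true. For $n=0$ step 8 is absent and stability omits $n$-choice consistency. -}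

module Defs where

open import Data.Bool.Base using (Bool; true; false)
open import Data.Fin.Base using (Fin) renaming (_<_ to _<ᶠ_)
open import Data.List.Base using (List; []; _∷_; _++_; length; map; concatMap)
open import Data.List.Membership.Propositional using (_∈_; _∉_)
open import Data.List.Relation.Binary.BagAndSetEquality using (_∼[_]_; set)
open import Data.List.Relation.Binary.Subset.Propositional using (_⊆_)
open import Data.List.Relation.Unary.Any using (Any)
open import Data.Nat.Base using (ℕ; suc; _≤_; _<_)
open import Data.Product using (∃; ∃₂; ∃!; _×_)
open import Data.Sum.Base using (_⊎_)
open import Function.Bundles using (_⇔_)
open import Function.Definitions using (Injective)
open import Level using (0ℓ)
open import Relation.Binary.Core using (Rel)
open import Relation.Binary.Construct.Closure.Equivalence using (EqClosure)
open import Relation.Binary.PropositionalEquality using (_≡_; _≢_)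
open import Relation.Nullary.Negation using (¬_)

infixr 7 _∧_
infixr 6 _∨_
infix  8 □_ ◇_ [1]_ ⟨1⟩_
infix  5 _⦂_
infixl 4 _,ᶠ_ _,ʳ_
infix  3 _⊢_

Atom Label : Set
Atom  = ℕ
Label = ℕ

data Formula : Set where
  pos neg               : Atom → Formula
  _∧_ _∨_               : Formula → Formula → Formula
  □_ ◇_ [1]_ ⟨1⟩_       : Formula → Formula

dual : Formula → Formula
dual (pos p)  = neg p
dual (neg p)  = pos p
dual (φ ∧ ψ)  = dual φ ∨ dual ψ
dual (φ ∨ ψ)  = dual φ ∧ dual ψ
dual (□ φ)    = ◇ dual φ
dual (◇ φ)    = □ dual φ
dual ([1] φ)  = ⟨1⟩ dual φ
dual (⟨1⟩ φ)  = [1] dual φ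

record RelAtom : Set where
  constructor R₁
  field source target : Label

record LFormula : Set where
  constructor _⦂_
  field
    label   : Label
    formula : Formula

-- The two multisets are represented by lists.  Every rule keeps its principal
-- formula and only adds material, and all rules below inspect a sequent through
-- membership alone, so the order of the lists plays no role.
record Sequent : Set where
  constructor _⸴_
  field
    rels : List RelAtom
    fmls : List LFormula

open Sequent public

_,ᶠ_ : Sequent → LFormula → Sequent
(ℛ ⸴ Γ) ,ᶠ A = ℛ ⸴ (A ∷ Γ)

_,ʳ_ : Sequent → RelAtom → Sequent
(ℛ ⸴ Γ) ,ʳ r = (r ∷ ℛ) ⸴ Γ

infix 4 _∈ᶠ_ _∉ᶠ_

_∈ᶠ_ _∉ᶠ_ : LFormula → Sequent → Set
A ∈ᶠ Λ = A ∈ fmls Λ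
A ∉ᶠ Λ = A ∉ fmls Λ

labels : Sequent → List Label
labels (ℛ ⸴ Γ) =
  concatMap (λ r → RelAtom.source r ∷ RelAtom.target r ∷ []) ℛ
  ++ map LFormula.label Γ

Fresh : Label → Sequent → Set
Fresh v Λ = v ∉ labels Λ

Edge : Sequent → Rel Label 0ℓ
Edge Λ x y = R₁ x y ∈ rels Λ

-- Λ is the conclusion.  The side condition of Pr₁ is EqClosure (Edge Λ):
-- a possibly empty sequence of edges, each traversed in either direction.
data _⊢_ (n : ℕ) (Λ : Sequent) : Set where
  id  : ∀ {w p} → (w ⦂ pos p) ∈ᶠ Λ → (w ⦂ neg p) ∈ᶠ Λ → n ⊢ Λ
  ∧R  : ∀ {w φ ψ} → (w ⦂ φ ∧ ψ) ∈ᶠ Λ →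
        n ⊢ Λ ,ᶠ (w ⦂ φ) → n ⊢ Λ ,ᶠ (w ⦂ ψ) → n ⊢ Λ
  ∨R  : ∀ {w φ ψ} → (w ⦂ φ ∨ ψ) ∈ᶠ Λ →
        n ⊢ Λ ,ᶠ (w ⦂ φ) ,ᶠ (w ⦂ ψ) → n ⊢ Λ
  □R  : ∀ {w φ v} → (w ⦂ □ φ) ∈ᶠ Λ → Fresh v Λ →
        n ⊢ Λ ,ᶠ (v ⦂ φ) → n ⊢ Λ
  ◇R  : ∀ {w φ u} → (w ⦂ ◇ φ) ∈ᶠ Λ →
        n ⊢ Λ ,ᶠ (u ⦂ φ) → n ⊢ Λ
  IOA : ∀ {u v} → Fresh v Λ →
        n ⊢ Λ ,ʳ R₁ u v → n ⊢ Λ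
  [1]R : ∀ {w φ v} → (w ⦂ [1] φ) ∈ᶠ Λ → Fresh v Λ →
        n ⊢ Λ ,ʳ R₁ w v ,ᶠ (v ⦂ φ) → n ⊢ Λ
  Pr₁ : ∀ {w φ u} → (w ⦂ ⟨1⟩ φ) ∈ᶠ Λ → EqClosure (Edge Λ) w u →
        n ⊢ Λ ,ᶠ (u ⦂ φ) → n ⊢ Λ
  APC : (ws : Fin (suc n) → Label) → 0 < n →
        (∀ {k j} → k <ᶠ j → n ⊢ Λ ,ʳ R₁ (ws k) (ws j)) → n ⊢ Λ

record Graph : Set₁ where
  field
    V : List Label
    E : Rel Label 0ℓ

open Graph

G : Sequent → Graph
G Λ = record { V = labels Λ ; E = Edge Λ }

_↾_ : Graph → List Label → Graph
𝒢 ↾ T = record { V = T ; E = λ x y → x ∈ T × y ∈ T × E 𝒢 x y }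

-- Path 𝒢 x ys y: a directed path from x to y, where ys lists the vertices visited
-- after x.  Paths are identified by their vertices, so repeated occurrences of a
-- relational atom in a sequent do not produce different paths.
data Path (𝒢 : Graph) : Label → List Label → Label → Set where
  []  : ∀ {x} → Path 𝒢 x [] x
  _∷_ : ∀ {x y z ys} → E 𝒢 x y → Path 𝒢 y ys z → Path 𝒢 x (y ∷ ys) z

IsRoot : Graph → Label → Set
IsRoot 𝒢 r = r ∈ V 𝒢 ×
  (∀ {y} → y ∈ V 𝒢 → y ≢ r → ∃! _≡_ (λ ys → Path 𝒢 r ys y))

IsTree : Graph → Set
IsTree 𝒢 = ∃ (IsRoot 𝒢)

-- T is the vertex set of a summand of 𝒢 in a decomposition of 𝒢 as a disjoint union.
IsSummand : Graph → List Label → Set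
IsSummand 𝒢 T = T ⊆ V 𝒢 × (∀ {x y} → E 𝒢 x y → x ∈ T ⇔ y ∈ T)

-- Choice-trees are given by their vertex sets.  When G Λ is a forest, these are
-- exactly the trees of which it is the disjoint union.
IsChoiceTree : Sequent → List Label → Set
IsChoiceTree Λ T = IsSummand (G Λ) T × IsTree (G Λ ↾ T)

IsChoiceTreeRoot : Sequent → Label → Set
IsChoiceTreeRoot Λ r = ∃ λ T → IsChoiceTree Λ T × IsRoot (G Λ ↾ T) r

infix 4 _∈CT[_]_

-- u ∈CT[ Λ ] w: the label u lies in CT(w).
_∈CT[_]_ : Label → Sequent → Label → Set
u ∈CT[ Λ ] w = ∃ λ T → IsChoiceTree Λ T × w ∈ T × u ∈ T

record Saturated (Λ : Sequent) (w : Label) : Set where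
  field
    consistent : ∀ {φ}   → (w ⦂ φ) ∈ᶠ Λ → (w ⦂ dual φ) ∉ᶠ Λ
    disj       : ∀ {φ ψ} → (w ⦂ φ ∨ ψ) ∈ᶠ Λ → (w ⦂ φ) ∈ᶠ Λ × (w ⦂ ψ) ∈ᶠ Λ
    conj       : ∀ {φ ψ} → (w ⦂ φ ∧ ψ) ∈ᶠ Λ → (w ⦂ φ) ∈ᶠ Λ ⊎ (w ⦂ ψ) ∈ᶠ Λ

□-Realized [1]-Realized ◇-Propagated ⟨1⟩-Propagated : Sequent → Label → Set
□-Realized     Λ w = ∀ {φ} → (w ⦂ □ φ) ∈ᶠ Λ → ∃ λ u → (u ⦂ φ) ∈ᶠ Λ
[1]-Realized   Λ w = ∀ {φ} → (w ⦂ [1] φ) ∈ᶠ Λ → ∃ λ u → u ∈CT[ Λ ] w × (u ⦂ φ) ∈ᶠ Λ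
◇-Propagated   Λ w = ∀ {φ} → (w ⦂ ◇ φ) ∈ᶠ Λ → ∀ {u} → u ∈ labels Λ → (u ⦂ φ) ∈ᶠ Λ
⟨1⟩-Propagated Λ w = ∀ {φ} → (w ⦂ ⟨1⟩ φ) ∈ᶠ Λ → ∀ {u} → u ∈CT[ Λ ] w → (u ⦂ φ) ∈ᶠ Λ

-- Lists with the same elements are the same choice-tree.
ChoiceConsistent : ℕ → Sequent → Set
ChoiceConsistent n Λ = ∃ λ (Ts : List (List Label)) → length Ts ≤ n ×
  (∀ {T} → IsChoiceTree Λ T → Any (λ T′ → T ∼[ set ] T′) Ts)

record Stable (n : ℕ) (Λ : Sequent) : Set where
  field
    saturated         : ∀ {w} → w ∈ labels Λ → Saturated Λ w
    □-realized        : ∀ {w} → w ∈ labels Λ → □-Realized Λ w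
    [1]-realized      : ∀ {w} → w ∈ labels Λ → [1]-Realized Λ w
    ◇-propagated      : ∀ {w} → w ∈ labels Λ → ◇-Propagated Λ w
    ⟨1⟩-propagated    : ∀ {w} → w ∈ labels Λ → ⟨1⟩-Propagated Λ w
    choice-consistent : 0 < n → ChoiceConsistent n Λ

-- Conditions under which the individual steps of the algorithm apply.  A violation
-- of ∨ or ∧ at w already makes w unsaturated.

Clash : Sequent → Set
Clash Λ = ∃₂ λ w p → (w ⦂ pos p) ∈ᶠ Λ × (w ⦂ neg p) ∈ᶠ Λ

∨-Todo ∧-Todo : Sequent → Label → Formula → Formula → Set
∨-Todo Λ w φ ψ = (w ⦂ φ ∨ ψ) ∈ᶠ Λ × ((w ⦂ φ) ∉ᶠ Λ ⊎ (w ⦂ ψ) ∉ᶠ Λ)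
∧-Todo Λ w φ ψ = (w ⦂ φ ∧ ψ) ∈ᶠ Λ × (w ⦂ φ) ∉ᶠ Λ × (w ⦂ ψ) ∉ᶠ Λ

⟨1⟩-Todo ◇-Todo : Sequent → Label → Formula → Label → Set
⟨1⟩-Todo Λ w φ u = (w ⦂ ⟨1⟩ φ) ∈ᶠ Λ × u ∈CT[ Λ ] w × (u ⦂ φ) ∉ᶠ Λ
◇-Todo   Λ w φ u = (w ⦂ ◇ φ) ∈ᶠ Λ × u ∈ labels Λ × (u ⦂ φ) ∉ᶠ Λ

[1]-Todo □-Todo : Sequent → Label → Formula → Set
[1]-Todo Λ w φ = (w ⦂ [1] φ) ∈ᶠ Λ × (∀ {u} → u ∈CT[ Λ ] w → (u ⦂ φ) ∉ᶠ Λ)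
□-Todo   Λ w φ = (w ⦂ □ φ) ∈ᶠ Λ × (∀ {u} → u ∈ labels Λ → (u ⦂ φ) ∉ᶠ Λ)

APC-Todo : (n : ℕ) → Sequent → (Fin (suc n) → Label) → Set
APC-Todo n Λ ws = 0 < n × ¬ ChoiceConsistent n Λ ×
  Injective _≡_ _≡_ ws × (∀ i → IsChoiceTreeRoot Λ (ws i))

-- Pastᵢ: none of the steps 1, …, i of the algorithm applies.
module _ (n : ℕ) (Λ : Sequent) where
  Past₁ Past₂ Past₃ Past₄ Past₅ Past₆ Past₇ : Set
  Past₁ = ¬ Clash Λ
  Past₂ = Past₁ × ¬ Stable n Λ
  Past₃ = Past₂ × (∀ {w φ ψ} → ¬ ∨-Todo Λ w φ ψ) × (∀ {w φ ψ} → ¬ ∧-Todo Λ w φ ψ)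
  Past₄ = Past₃ × (∀ {w φ u} → ¬ ⟨1⟩-Todo Λ w φ u)
  Past₅ = Past₄ × (∀ {w φ u} → ¬ ◇-Todo Λ w φ u)
  Past₆ = Past₅ × (∀ {w φ} → ¬ [1]-Todo Λ w φ)
  Past₇ = Past₆ × (∀ {w φ} → ¬ □-Todo Λ w φ)

infix 3 Prove[_]_returns_

-- Prove[ n ] Λ returns b: some run of the algorithm on Λ terminates with answer b.
-- The algorithm leaves open which labels, formulas and fresh labels are picked, so it
-- is given as a big-step relation that admits every choice.
data Prove[_]_returns_ (n : ℕ) (Λ : Sequent) : Bool → Set where
  step1    : Clash Λ → Prove[ n ] Λ returns true
  step2    : Past₁ n Λ → Stable n Λ → Prove[ n ] Λ returns false
  step3∨   : ∀ {w φ ψ b} → Past₂ n Λ → ∨-Todo Λ w φ ψ →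
             Prove[ n ] Λ ,ᶠ (w ⦂ φ) ,ᶠ (w ⦂ ψ) returns b →
             Prove[ n ] Λ returns b
  step3∧ˡ  : ∀ {w φ ψ} → Past₂ n Λ → ∧-Todo Λ w φ ψ →
             Prove[ n ] Λ ,ᶠ (w ⦂ φ) returns false →
             Prove[ n ] Λ returns false
  step3∧ʳ  : ∀ {w φ ψ} → Past₂ n Λ → ∧-Todo Λ w φ ψ →
             Prove[ n ] Λ ,ᶠ (w ⦂ ψ) returns false →
             Prove[ n ] Λ returns false
  step3∧   : ∀ {w φ ψ} → Past₂ n Λ → ∧-Todo Λ w φ ψ →
             Prove[ n ] Λ ,ᶠ (w ⦂ φ) returns true →
             Prove[ n ] Λ ,ᶠ (w ⦂ ψ) returns true →
             Prove[ n ] Λ returns true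
  step4    : ∀ {w φ u b} → Past₃ n Λ → ⟨1⟩-Todo Λ w φ u →
             Prove[ n ] Λ ,ᶠ (u ⦂ φ) returns b →
             Prove[ n ] Λ returns b
  step5    : ∀ {w φ u b} → Past₄ n Λ → ◇-Todo Λ w φ u →
             Prove[ n ] Λ ,ᶠ (u ⦂ φ) returns b →
             Prove[ n ] Λ returns b
  step6    : ∀ {w φ v b} → Past₅ n Λ → [1]-Todo Λ w φ → Fresh v Λ →
             Prove[ n ] Λ ,ʳ R₁ w v ,ᶠ (v ⦂ φ) returns b →
             Prove[ n ] Λ returns b
  step7    : ∀ {w φ v b} → Past₆ n Λ → □-Todo Λ w φ → Fresh v Λ →
             Prove[ n ] Λ ,ᶠ (v ⦂ φ) returns b →
             Prove[ n ] Λ returns b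
  step8-no : ∀ {ws k j} → Past₇ n Λ → APC-Todo n Λ ws → k <ᶠ j →
             Prove[ n ] Λ ,ʳ R₁ (ws k) (ws j) returns false →
             Prove[ n ] Λ returns false
  step8-ok : ∀ {ws} → Past₇ n Λ → APC-Todo n Λ ws →
             (∀ {k j} → k <ᶠ j → Prove[ n ] Λ ,ʳ R₁ (ws k) (ws j) returns true) →
             Prove[ n ] Λ returns true

[_]ˢ : LFormula → Sequent
[ A ]ˢ = [] ⸴ (A ∷ [])

{-# OPTIONS --safe #-}

-- An answer "false" ends in a stable forestlike sequent extending the input.  Since
-- the calculus has no cut, such a sequent Λ refutes derivability directly, without
-- passing through a Kripke model: a map of labels that sends the formulas of Δ into Λ
-- and its edges into choice-trees can be carried from the conclusion Δ of a rule to
-- one of its premises, and it cannot exist at an (id) leaf.  For (APC) the premise is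
-- found by the pigeonhole principle, since n+1 labels land in at most n choice-trees.
module Submission where

open import Defs
open import Data.Bool.Base using (true; false)
open import Data.Empty using (⊥-elim)
open import Data.Fin.Base using (Fin) renaming (_<_ to _<ᶠ_)
open import Data.Fin.Properties as Fin using (pigeonhole)
open import Data.List.Base using (List; []; _∷_; _++_; _∷ʳ_; concatMap; lookup)
open import Data.List.Membership.DecPropositional using (_∈?_)
open import Data.List.Membership.Propositional using (_∈_; _∉_)
open import Data.List.Membership.Propositional.Properties using (∈-++⁺ˡ; ∈-++⁺ʳ; ∈-++⁻; ∈-map⁺)
open import Data.List.Properties using (++-assoc; ++-identityʳ)
open import Data.List.Relation.Binary.BagAndSetEquality using (_∼[_]_; set)
open import Data.List.Relation.Binary.Subset.Propositional using (_⊆_)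
open import Data.List.Relation.Unary.Any using (Any; here; there; index)
open import Data.List.Relation.Unary.Any.Properties using (lookup-index)
open import Data.Nat.Base using (ℕ; suc; s≤s)
open import Data.Nat.Properties using (_≟_)
open import Data.Product.Base using (∃; ∃₂; _×_; _,_; proj₁; proj₂; -,_)
open import Data.Sum.Base using (_⊎_; inj₁; inj₂; [_,_]′)
open import Function.Base using (_∘_)
open import Function.Bundles using (_⇔_; mk⇔; module Equivalence)
open import Function.Properties.Equivalence using (⇔-isEquivalence)
open import Level using (0ℓ)
open import Relation.Binary.Core using (Rel)
open import Relation.Binary.Construct.Closure.Equivalence as EqClosure using (EqClosure)
open import Relation.Binary.Construct.Closure.ReflexiveTransitive as Star using (Star; ε; _◅_; _◅◅_)
open import Relation.Binary.Construct.Closure.Symmetric using (fwd)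
open import Relation.Binary.PropositionalEquality
  using (_≡_; _≢_; refl; sym; trans; cong; subst; subst₂)
open import Relation.Nullary.Decidable using (yes; no)
open import Relation.Nullary.Negation using (¬_; contradiction)

open Equivalence using (to; from)

private variable
  E                 : Rel Label 0ℓ
  n                 : ℕ
  Λ Δ               : Sequent
  T U ys zs         : List Label
  a r s u v w x y z : Label
  φ                 : Formula
  A                 : LFormula

-- Labels occurring in a sequent

label∈labels : ∀ Λ → (w ⦂ φ) ∈ᶠ Λ → w ∈ labels Λ
label∈labels Λ w∈ = ∈-++⁺ʳ (concatMap _ (rels Λ)) (∈-map⁺ LFormula.label w∈)

edge⇒∈labels : ∀ Λ → Edge Λ x y → x ∈ labels Λ × y ∈ labels Λ
edge⇒∈labels ((_ ∷ _) ⸴ _) (here refl) = here refl , there (here refl)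
edge⇒∈labels ((_ ∷ ℛ) ⸴ Γ) (there e)   =
  let x∈ , y∈ = edge⇒∈labels (ℛ ⸴ Γ) e in there (there x∈) , there (there y∈)

labels-,ᶠ⁺ : ∀ Λ → labels Λ ⊆ labels (Λ ,ᶠ A)
labels-,ᶠ⁺ Λ =
  [ ∈-++⁺ˡ , ∈-++⁺ʳ (concatMap _ (rels Λ)) ∘ there ]′ ∘ ∈-++⁻ (concatMap _ (rels Λ))

labels-,ᶠ⁻ : ∀ Λ → x ∈ labels (Λ ,ᶠ (v ⦂ φ)) → x ≡ v ⊎ x ∈ labels Λ
labels-,ᶠ⁻ Λ x∈ with ∈-++⁻ (concatMap _ (rels Λ)) x∈
... | inj₁ x∈ℛ         = inj₂ (∈-++⁺ˡ x∈ℛ)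
... | inj₂ (here x≡v)  = inj₁ x≡v
... | inj₂ (there x∈Γ) = inj₂ (∈-++⁺ʳ (concatMap _ (rels Λ)) x∈Γ)

-- Choice-trees as connected components

summand-closed : ∀ Λ → IsSummand (G Λ) T → EqClosure (Edge Λ) x y → x ∈ T ⇔ y ∈ T
summand-closed {T = T} _ (_ , cl) = EqClosure.gfold ⇔-isEquivalence (_∈ T) cl

path⇒star : ∀ Λ → Path (G Λ ↾ T) x ys y → Star (Edge Λ) x y
path⇒star Λ []                = ε
path⇒star Λ ((_ , _ , e) ∷ p) = e ◅ path⇒star Λ p

root-reaches : ∀ Λ → IsRoot (G Λ ↾ T) r → y ∈ T → Star (Edge Λ) r y
root-reaches {r = r} {y = y} Λ (_ , unique) y∈ with y ≟ r
... | yes refl = ε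
... | no y≢r   = let _ , p , _ = unique y∈ y≢r in path⇒star Λ p

star⇒eq : Star E x y → EqClosure E x y
star⇒eq = Star.map fwd

reaches⇒connected : (∀ {z} → z ∈ T → Star E r z) → x ∈ T → y ∈ T → EqClosure E x y
reaches⇒connected reach x∈ y∈ =
  EqClosure.symmetric _ (star⇒eq (reach x∈)) ◅◅ star⇒eq (reach y∈)

choiceTree-connected : ∀ Λ → IsChoiceTree Λ T → x ∈ T → y ∈ T → EqClosure (Edge Λ) x y
choiceTree-connected Λ (_ , _ , root) = reaches⇒connected (root-reaches Λ root)

∈CT⇒connected : ∀ Λ → u ∈CT[ Λ ] w → EqClosure (Edge Λ) w u
∈CT⇒connected Λ (_ , tree , w∈ , u∈) = choiceTree-connected Λ tree w∈ u∈

-- Derivations from the answer true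

-- Each step that can answer true is a rule read upwards, with the recursive calls as premises. In
-- step 4 the side condition of `Pr₁` holds because a choice-tree is connected through its root.
true⇒derivable : Prove[ n ] Λ returns true → n ⊢ Λ
true⇒derivable (step1 (_ , _ , p , p̄))                  = id p p̄
true⇒derivable (step3∨ _ (∨∈ , _) run)                  = ∨R ∨∈ (true⇒derivable run)
true⇒derivable (step3∧ _ (∧∈ , _) run₁ run₂)            = ∧R ∧∈ (true⇒derivable run₁) (true⇒derivable run₂)
true⇒derivable (step4 _ (⟨1⟩∈ , u∈ , _) run)            = Pr₁ ⟨1⟩∈ (∈CT⇒connected _ u∈) (true⇒derivable run)
true⇒derivable (step5 _ (◇∈ , _) run)                   = ◇R ◇∈ (true⇒derivable run)
true⇒derivable (step6 _ ([1]∈ , _) fresh run)           = [1]R [1]∈ fresh (true⇒derivable run)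
true⇒derivable (step7 _ (□∈ , _) fresh run)             = □R □∈ fresh (true⇒derivable run)
true⇒derivable (step8-ok {ws = ws} _ (0<n , _) runs)    = APC ws 0<n (λ k<j → true⇒derivable (runs k<j))

-- Forestlike sequents

Parentless : Sequent → Label → Set
Parentless Λ r = ∀ {x} → ¬ Edge Λ x r

-- Reachability gives the existence of the paths demanded by `IsRoot`; their uniqueness comes from
-- `parent-unique` together with the parentless root, see `walk-unique`.
record Tree (Λ : Sequent) (T : List Label) (r : Label) : Set where
  field
    root∈      : r ∈ T
    summand    : IsSummand (G Λ) T
    parentless : Parentless Λ r
    reaches    : y ∈ T → Star (Edge Λ) r y

  connected : x ∈ T → y ∈ T → EqClosure (Edge Λ) x y
  connected = reaches⇒connected reaches

-- Unique paths are replaced by unique predecessors, an invariant that is local to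
-- the edges and hence easy to maintain when edges are added.
record Forest (Λ : Sequent) : Set where
  field
    parent-unique : Edge Λ x z → Edge Λ y z → x ≡ y
    cover         : x ∈ labels Λ → ∃₂ λ T r → Tree Λ T r × x ∈ T

open Tree
open Forest

-- Edges are added at the far end, unlike in `Path`: since predecessors are unique, two walks are
-- best compared from their last edges.
data Walk (Λ : Sequent) (r : Label) : List Label → Label → Set where
  []  : Walk Λ r [] r
  _▷_ : Walk Λ r ys y → Edge Λ y z → Walk Λ r (ys ∷ʳ z) z

path⇒walk : Walk Λ r ys y → Path (G Λ ↾ T) y zs z → Walk Λ r (ys ++ zs) z
path⇒walk {ys = ys} q [] = subst (λ l → Walk _ _ l _) (sym (++-identityʳ ys)) q
path⇒walk {ys = ys} q ((_ , _ , e) ∷ p) =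
  subst (λ l → Walk _ _ l _) (++-assoc ys _ _) (path⇒walk (q ▷ e) p)

-- Last edges into the same vertex start at the same vertex, so the comparison recurses backwards.
-- Neither walk can be exhausted before the other, since no edge enters `r`.
walk-unique : Forest Λ → Parentless Λ r → Walk Λ r ys y → Walk Λ r zs y → ys ≡ zs
walk-unique F r↛ []      []      = refl
walk-unique F r↛ []      (_ ▷ e) = contradiction e r↛
walk-unique F r↛ (_ ▷ e) []      = contradiction e r↛
walk-unique F r↛ (p ▷ e) (q ▷ f) with refl ← parent-unique F e f =
  cong (_∷ʳ _) (walk-unique F r↛ p q)

star⇒path : ∀ Λ → IsSummand (G Λ) T → x ∈ T → Star (Edge Λ) x y → ∃ λ ys → Path (G Λ ↾ T) x ys y
star⇒path Λ S x∈ ε = [] , []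
star⇒path Λ S x∈ (e ◅ es) =
  let y∈ = to (proj₂ S e) x∈
      _ , p = star⇒path Λ S y∈ es
  in -, (x∈ , y∈ , e) ∷ p

tree⇒choiceTree : Forest Λ → Tree Λ T r → IsChoiceTree Λ T
tree⇒choiceTree F t = summand t , -, root∈ t , λ y∈ _ →
  let ys , p = star⇒path _ (summand t) (root∈ t) (reaches t y∈)
  in ys , p , λ q → walk-unique F (parentless t) (path⇒walk [] p) (path⇒walk [] q)

-- `cover` provides a choice-tree around `w`, and a summand is closed under edges in both
-- directions. With `∈CT⇒connected` this identifies choice-trees with connected components.
connected⇒∈CT : Forest Λ → w ∈ labels Λ → EqClosure (Edge Λ) w u → u ∈CT[ Λ ] w
connected⇒∈CT {Λ = Λ} F w∈ w~u =
  let T , _ , t , w∈T = cover F w∈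
  in T , tree⇒choiceTree F t , w∈T , to (summand-closed Λ (summand t) w~u) w∈T

star-to-parentless : (∀ {y} → ¬ E y r) → Star E x r → x ≡ r
star-to-parentless r↛ ε = refl
star-to-parentless r↛ (e ◅ es) with refl ← star-to-parentless r↛ es = contradiction e r↛

-- The parentless root `r₀` of the covering tree lies in `T` by connectedness, so `r` reaches it;
-- but only `r₀` itself reaches a parentless vertex, hence `r` is `r₀`.
choiceTreeRoot⇒tree : Forest Λ → IsChoiceTreeRoot Λ r → ∃ λ T → Tree Λ T r
choiceTreeRoot⇒tree {Λ = Λ} F (T , (S , _) , root@(r∈T , _))
  with U , r₀ , t , r∈U ← cover F (proj₁ S r∈T)
  with refl ← star-to-parentless (parentless t)
                (root-reaches Λ root (to (summand-closed Λ S (connected t r∈U (root∈ t))) r∈T))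
  = U , t

-- Preservation of forestlikeness

tree-,ᶠ : Tree Λ T r → Tree (Λ ,ᶠ A) T r
tree-,ᶠ {Λ = Λ} {A = A} t = record
  { root∈      = root∈ t
  ; summand    = labels-,ᶠ⁺ {A = A} Λ ∘ proj₁ (summand t) , proj₂ (summand t)
  ; parentless = parentless t
  ; reaches    = reaches t
  }

singletonTree : Fresh v Λ → Tree (Λ ,ᶠ (v ⦂ φ)) (v ∷ []) v
singletonTree {v = v} {Λ = Λ} {φ = φ} fresh = record
  { root∈      = here refl
  ; summand    = (λ { (here refl) → label∈labels (Λ ,ᶠ (v ⦂ φ)) (here refl) })
               , λ e → mk⇔ (λ { (here refl) → contradiction (proj₁ (edge⇒∈labels Λ e)) fresh })
                           (λ { (here refl) → contradiction (proj₂ (edge⇒∈labels Λ e)) fresh })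
  ; parentless = λ e → fresh (proj₂ (edge⇒∈labels Λ e))
  ; reaches    = λ { (here refl) → ε }
  }

forest-,ᶠ : Forest Λ → Forest (Λ ,ᶠ A)
forest-,ᶠ {Λ = Λ} {A = v ⦂ φ} F = record { parent-unique = parent-unique F ; cover = cover′ }
  where
  old : x ∈ labels Λ → ∃₂ λ T r → Tree (Λ ,ᶠ (v ⦂ φ)) T r × x ∈ T
  old x∈ = let _ , _ , t , x∈T = cover F x∈ in -, -, tree-,ᶠ t , x∈T

  cover′ : x ∈ labels (Λ ,ᶠ (v ⦂ φ)) → ∃₂ λ T r → Tree (Λ ,ᶠ (v ⦂ φ)) T r × x ∈ T
  cover′ x∈ with labels-,ᶠ⁻ {φ = φ} Λ x∈
  ... | inj₂ x∈Λ = old x∈Λ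
  ... | inj₁ refl with _∈?_ _≟_ v (labels Λ)
  ...   | yes v∈Λ  = old v∈Λ
  -- A label foreign to `Λ` touches no edge and so forms a tree on its own.
  ...   | no fresh = -, -, singletonTree fresh , here refl

-- The new edge enters only `s`, so `r ≢ s` keeps `r` parentless; vertices of `U` are reached
-- through `a` and then `s`.
graft-tree : Tree Λ T r → Tree Λ U s → a ∈ T → r ≢ s → Tree (Λ ,ʳ R₁ a s) (T ++ U) r
graft-tree {Λ = Λ} {T = T} {r = r} {U = U} {s = s} {a = a} t t′ a∈ r≢s = record
  { root∈      = ∈-++⁺ˡ (root∈ t)
  ; summand    = (λ x∈ → there (there ([ proj₁ (summand t) , proj₁ (summand t′) ]′ (∈-++⁻ T x∈))))
               , λ { (here refl) → mk⇔ (λ _ → s∈) (λ _ → ∈-++⁺ˡ a∈)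
                   ; (there e)   → mk⇔ (transport (to (proj₂ (summand t) e)) (to (proj₂ (summand t′) e)))
                                       (transport (from (proj₂ (summand t) e)) (from (proj₂ (summand t′) e))) }
  ; parentless = λ { (here refl) → r≢s refl ; (there e) → parentless t e }
  ; reaches    = λ y∈ → [ lift ∘ reaches t
                        , (λ y∈U → lift (reaches t a∈) ◅◅ here refl ◅ lift (reaches t′ y∈U)) ]′
                        (∈-++⁻ T y∈)
  }
  where
  s∈ : s ∈ T ++ U
  s∈ = ∈-++⁺ʳ T (root∈ t′)

  transport : (x ∈ T → y ∈ T) → (x ∈ U → y ∈ U) → x ∈ T ++ U → y ∈ T ++ U
  transport f g = [ ∈-++⁺ˡ ∘ f , ∈-++⁺ʳ T ∘ g ]′ ∘ ∈-++⁻ T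

  lift : Star (Edge Λ) x y → Star (Edge (Λ ,ʳ R₁ a s)) x y
  lift = Star.map there

forest-graft : Forest Λ → Tree Λ T r → Tree Λ U s → a ∈ T → r ≢ s → Forest (Λ ,ʳ R₁ a s)
forest-graft {Λ = Λ} {T = T} {r = r} {U = U} {s = s} {a = a} F t t′ a∈ r≢s = record
  { parent-unique = λ { (here refl) (here refl) → refl
                      ; (here refl) (there f)   → contradiction f (parentless t′)
                      ; (there e)   (here refl) → contradiction e (parentless t′)
                      ; (there e)   (there f)   → parent-unique F e f }
  ; cover = λ { (here refl)         → joined (∈-++⁺ˡ a∈)
              ; (there (here refl)) → joined (∈-++⁺ʳ T (root∈ t′))
              ; (there (there x∈))  → old x∈ }
  }
  where
  joined : x ∈ T ++ U → ∃₂ λ T′ r′ → Tree (Λ ,ʳ R₁ a s) T′ r′ × x ∈ T′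
  joined x∈ = -, -, graft-tree t t′ a∈ r≢s , x∈

  old : x ∈ labels Λ → ∃₂ λ T′ r′ → Tree (Λ ,ʳ R₁ a s) T′ r′ × x ∈ T′
  old {x = x} x∈ with _∈?_ _≟_ x (T ++ U)
  ... | yes x∈TU = joined x∈TU
  -- A tree around a label outside `T ++ U` contains neither end of the new edge, since
  -- connectedness would otherwise put that label into `T` or `U`. So it survives unchanged.
  ... | no x∉TU with T₀ , r₀ , t₀ , x∈T₀ ← cover F x∈ = T₀ , r₀ , t₀′ , x∈T₀
    where
    a∉ : a ∉ T₀
    a∉ a∈₀ = x∉TU (∈-++⁺ˡ (to (summand-closed Λ (summand t) (connected t₀ a∈₀ x∈T₀)) a∈))

    s∉ : s ∉ T₀
    s∉ s∈₀ = x∉TU (∈-++⁺ʳ T (to (summand-closed Λ (summand t′) (connected t₀ s∈₀ x∈T₀)) (root∈ t′)))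

    t₀′ : Tree (Λ ,ʳ R₁ a s) T₀ r₀
    t₀′ = record
      { root∈      = root∈ t₀
      ; summand    = there ∘ there ∘ proj₁ (summand t₀)
                   , λ { (here refl) → mk⇔ (⊥-elim ∘ a∉) (⊥-elim ∘ s∉)
                       ; (there e)   → proj₂ (summand t₀) e }
      ; parentless = λ { (here refl) → s∉ (root∈ t₀) ; (there e) → parentless t₀ e }
      ; reaches    = Star.map there ∘ reaches t₀
      }

-- Step 6 is a graft of the one-vertex tree of `v`, which exists once its formula is added. The two
-- extensions commute by computation.
forest-newLeaf : Forest Λ → w ∈ labels Λ → Fresh v Λ → Forest (Λ ,ʳ R₁ w v ,ᶠ (v ⦂ φ))
forest-newLeaf F w∈ fresh with T , r , t , w∈T ← cover F w∈ =
  forest-graft (forest-,ᶠ F) (tree-,ᶠ t) (singletonTree fresh) w∈T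
    λ { refl → fresh (proj₁ (summand t) (root∈ t)) }

forest-joinRoots : Forest Λ → IsChoiceTreeRoot Λ r → IsChoiceTreeRoot Λ s → r ≢ s → Forest (Λ ,ʳ R₁ r s)
forest-joinRoots F rootʳ rootˢ r≢s =
  let _ , t = choiceTreeRoot⇒tree F rootʳ
      _ , t′ = choiceTreeRoot⇒tree F rootˢ
  in forest-graft F t t′ (root∈ t) r≢s

forest-[_]ˢ : ∀ A → Forest [ A ]ˢ
forest-[ A ]ˢ = forest-,ᶠ {Λ = [] ⸴ []} record { parent-unique = λ () ; cover = λ () }

-- Stable extensions from the answer false

-- Only formulas are tracked, because the input of the theorem has no relational atoms to preserve.
StableExtension : ℕ → List LFormula → Set
StableExtension n Γ = ∃ λ Λ′ → Γ ⊆ fmls Λ′ × Forest Λ′ × Stable n Λ′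

shrink : ∀ {Γ Γ′} → Γ ⊆ Γ′ → StableExtension n Γ′ → StableExtension n Γ
shrink Γ⊆Γ′ (Λ′ , Γ′⊆Λ′ , rest) = Λ′ , Γ′⊆Λ′ ∘ Γ⊆Γ′ , rest

-- Outside step 2, an answer false rests on one recursive call that answered false. Following these
-- calls leads to the stable sequent, with forestlikeness maintained on the way.
false⇒stableExtension : Prove[ n ] Λ returns false → Forest Λ → StableExtension n (fmls Λ)
false⇒stableExtension (step2 _ stable) F = -, (λ A∈ → A∈) , F , stable
false⇒stableExtension (step3∨ _ _ run) F =
  shrink (there ∘ there) (false⇒stableExtension run (forest-,ᶠ (forest-,ᶠ F)))
false⇒stableExtension (step3∧ˡ _ _ run) F = shrink there (false⇒stableExtension run (forest-,ᶠ F))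
false⇒stableExtension (step3∧ʳ _ _ run) F = shrink there (false⇒stableExtension run (forest-,ᶠ F))
false⇒stableExtension (step4 _ _ run) F = shrink there (false⇒stableExtension run (forest-,ᶠ F))
false⇒stableExtension (step5 _ _ run) F = shrink there (false⇒stableExtension run (forest-,ᶠ F))
false⇒stableExtension {Λ = Λ} (step6 _ ([1]∈ , _) fresh run) F =
  shrink there (false⇒stableExtension run (forest-newLeaf F (label∈labels Λ [1]∈) fresh))
false⇒stableExtension (step7 _ _ _ run) F = shrink there (false⇒stableExtension run (forest-,ᶠ F))
false⇒stableExtension (step8-no {k = k} {j = j} _ (_ , _ , inj , roots) k<j run) F =
  false⇒stableExtension run (forest-joinRoots F (roots k) (roots j) (Fin.<⇒≢ k<j ∘ inj))

-- Embeddings of sequents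

_[_↦_] : (Label → Label) → Label → Label → Label → Label
(I [ v ↦ u ]) x with x ≟ v
... | yes _ = u
... | no  _ = I x

↦-same : ∀ I v → (I [ v ↦ u ]) v ≡ u
↦-same I v with v ≟ v
... | yes _  = refl
... | no v≢v = contradiction refl v≢v

↦-other : (I : Label → Label) → x ≢ v → (I [ v ↦ u ]) x ≡ I x
↦-other {x = x} {v = v} I x≢v with x ≟ v
... | yes x≡v = contradiction x≡v x≢v
... | no _    = refl

-- `onLabels` ranges over all labels because `◇R`, `IOA` and `APC` may mention labels not occurring
-- in `Δ`. Edges go only to connected pairs, which is what `[1]-Realized` and the pigeonhole
-- argument deliver.
record Embedding (Δ Λ : Sequent) (I : Label → Label) : Set where
  field
    onLabels   : ∀ x → I x ∈ labels Λ
    onEdges    : Edge Δ x y → EqClosure (Edge Λ) (I x) (I y)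
    onFormulas : (x ⦂ φ) ∈ᶠ Δ → (I x ⦂ φ) ∈ᶠ Λ

open Embedding

private variable
  I : Label → Label

embed-,ᶠ : Embedding Δ Λ I → (I x ⦂ φ) ∈ᶠ Λ → Embedding (Δ ,ᶠ (x ⦂ φ)) Λ I
embed-,ᶠ ι φ∈ = record
  { onLabels   = onLabels ι
  ; onEdges    = onEdges ι
  ; onFormulas = λ { (here refl) → φ∈ ; (there ψ∈) → onFormulas ι ψ∈ }
  }

embed-,ʳ : Embedding Δ Λ I → EqClosure (Edge Λ) (I x) (I y) → Embedding (Δ ,ʳ R₁ x y) Λ I
embed-,ʳ ι x~y = record
  { onLabels   = onLabels ι
  ; onEdges    = λ { (here refl) → x~y ; (there e) → onEdges ι e }
  ; onFormulas = onFormulas ι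
  }

fresh≢ : ∀ Δ → Fresh v Δ → x ∈ labels Δ → x ≢ v
fresh≢ _ fresh x∈ refl = fresh x∈

-- Redirecting `I` at `v` is harmless, as every label in an edge or formula of `Δ` differs from the
-- fresh `v`.
embed-fresh : Embedding Δ Λ I → Fresh v Δ → u ∈ labels Λ → Embedding Δ Λ (I [ v ↦ u ])
embed-fresh {Δ = Δ} {Λ = Λ} {I = I} {v = v} {u = u} ι fresh u∈ = record
  { onLabels   = onLabels′
  ; onEdges    = λ e → let x∈ , y∈ = edge⇒∈labels Δ e in
      subst₂ (EqClosure (Edge Λ)) (unchanged x∈) (unchanged y∈) (onEdges ι e)
  ; onFormulas = λ φ∈ → subst (λ x → (x ⦂ _) ∈ᶠ Λ) (unchanged (label∈labels Δ φ∈)) (onFormulas ι φ∈)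
  }
  where
  unchanged : x ∈ labels Δ → I x ≡ (I [ v ↦ u ]) x
  unchanged x∈ = sym (↦-other I (fresh≢ Δ fresh x∈))

  onLabels′ : ∀ x → (I [ v ↦ u ]) x ∈ labels Λ
  onLabels′ x with x ≟ v
  ... | yes _ = u∈
  ... | no  _ = onLabels ι x

connected-image : Embedding Δ Λ I → EqClosure (Edge Δ) x y → EqClosure (Edge Λ) (I x) (I y)
connected-image {Λ = Λ} {I = I} ι = EqClosure.gfold (EqClosure.isEquivalence (Edge Λ)) I (onEdges ι)

-- Refutation of derivability

choiceTrees-collide : Forest Λ → ChoiceConsistent n Λ → (xs : Fin (suc n) → Label) →
  (∀ i → xs i ∈ labels Λ) → ∃₂ λ k j → k <ᶠ j × EqClosure (Edge Λ) (xs k) (xs j)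
choiceTrees-collide {Λ = Λ} {n = n} F (Ts , length≤n , listed) xs xs∈ =
  -- The `suc n` labels are sorted by the position of their tree in `Ts`. Equal positions mean equal
  -- vertex sets, so `xs j` also lies in the tree of `xs k`.
  let k , j , k<j , same = pigeonhole (s≤s length≤n) (index ∘ listedAt)
      k⇔ = lookup-index (listedAt k)
      j⇔ = subst (λ i → tree j ∼[ set ] lookup Ts i)
                 (sym same) (lookup-index (listedAt j))
  in k , j , k<j , choiceTree-connected Λ (isTree k) (in-tree k) (from k⇔ (to j⇔ (in-tree j)))
  where
  tree : Fin (suc n) → List Label
  tree i = proj₁ (cover F (xs∈ i))
  isTree : ∀ i → IsChoiceTree Λ (tree i)
  isTree i = let _ , _ , t , _ = cover F (xs∈ i) in tree⇒choiceTree F t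
  in-tree : ∀ i → xs i ∈ tree i
  in-tree i = let _ , _ , _ , x∈ = cover F (xs∈ i) in x∈
  listedAt : ∀ i → Any (tree i ∼[ set ]_) Ts
  listedAt i = listed (isTree i)

-- Induction on the derivation with `I` varying: stability of `Λ` selects a premise, or a value for
-- a fresh label, to which the embedding extends.
stable⇒¬derivable : Forest Λ → Stable n Λ → n ⊢ Δ → ¬ Embedding Δ Λ I
stable⇒¬derivable {Λ = Λ} {n = n} F stable = refute
  where
  open Stable stable

  refute : n ⊢ Δ → ¬ Embedding Δ Λ I
  refute (id p∈ p̄∈) ι =
    Saturated.consistent (saturated (onLabels ι _)) (onFormulas ι p∈) (onFormulas ι p̄∈)
  refute (∧R ∧∈ d₁ d₂) ι with Saturated.conj (saturated (onLabels ι _)) (onFormulas ι ∧∈)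
  ... | inj₁ φ∈ = refute d₁ (embed-,ᶠ ι φ∈)
  ... | inj₂ ψ∈ = refute d₂ (embed-,ᶠ ι ψ∈)
  refute (∨R ∨∈ d) ι =
    let φ∈ , ψ∈ = Saturated.disj (saturated (onLabels ι _)) (onFormulas ι ∨∈)
    in refute d (embed-,ᶠ (embed-,ᶠ ι φ∈) ψ∈)
  refute {I = I} (□R {v = v} □∈ fresh d) ι =
    let _ , φ∈ = □-realized (onLabels ι _) (onFormulas ι □∈)
    in refute d (embed-,ᶠ (embed-fresh ι fresh (label∈labels Λ φ∈))
                          (subst (λ x → (x ⦂ _) ∈ᶠ Λ) (sym (↦-same I v)) φ∈))
  refute (◇R ◇∈ d) ι =
    refute d (embed-,ᶠ ι (◇-propagated (onLabels ι _) (onFormulas ι ◇∈) (onLabels ι _)))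
  -- The fresh label is sent to the image of `u`, so the new edge collapses to the empty path.
  refute {I = I} (IOA {u = u} {v = v} fresh d) ι =
    refute d (embed-,ʳ (embed-fresh ι fresh (onLabels ι u))
                       (subst (EqClosure (Edge Λ) _) (trans same (sym (↦-same I v))) ε))
    where
    -- The rule admits u ≡ v.
    same : (I [ v ↦ I u ]) u ≡ I u
    same with u ≟ v
    ... | yes _ = refl
    ... | no  _ = refl
  refute {Δ = Δ} {I = I} ([1]R {v = v} [1]∈ fresh d) ι =
    let _ , u∈CT , φ∈ = [1]-realized (onLabels ι _) (onFormulas ι [1]∈)
        w≢v = fresh≢ Δ fresh (label∈labels Δ [1]∈)
    in refute d (embed-,ᶠ (embed-,ʳ (embed-fresh ι fresh (label∈labels Λ φ∈))
                             (subst₂ (EqClosure (Edge Λ)) (sym (↦-other I w≢v)) (sym (↦-same I v))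
                                     (∈CT⇒connected Λ u∈CT)))
                          (subst (λ x → (x ⦂ _) ∈ᶠ Λ) (sym (↦-same I v)) φ∈))
  -- The path of the side condition is carried into `Λ`, which places the image of `u` in the
  -- choice-tree of the image of `w`.
  refute (Pr₁ ⟨1⟩∈ w~u d) ι =
    refute d (embed-,ᶠ ι (⟨1⟩-propagated (onLabels ι _) (onFormulas ι ⟨1⟩∈)
                            (connected⇒∈CT F (onLabels ι _) (connected-image ι w~u))))
  refute {I = I} (APC ws 0<n ds) ι =
    let _ , _ , k<j , k~j = choiceTrees-collide F (choice-consistent 0<n) (I ∘ ws) (onLabels ι ∘ ws)
    in refute (ds k<j) (embed-,ʳ ι k~j)

false⇒¬derivable : Prove[ n ] [ w ⦂ φ ]ˢ returns false → ¬ (n ⊢ [ w ⦂ φ ]ˢ)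
false⇒¬derivable {w = w} run d with Λ , φ⊆Λ , F , stable ← false⇒stableExtension run forest-[ _ ]ˢ =
  -- A constant map suffices: `w` is the only label of the input, there are no edges, and `w` occurs
  -- in `Λ` with `φ`.
  stable⇒¬derivable {I = λ _ → w} F stable d record
    { onLabels   = λ _ → label∈labels Λ (φ⊆Λ (here refl))
    ; onEdges    = λ ()
    ; onFormulas = λ { (here refl) → φ⊆Λ (here refl) }
    }

theorem5 : (n : ℕ) (φ : Formula) (w : Label) →
    ((Prove[ n ] [ w ⦂ φ ]ˢ returns true) → n ⊢ [ w ⦂ φ ]ˢ) ×
    ((Prove[ n ] [ w ⦂ φ ]ˢ returns false) → ¬ (n ⊢ [ w ⦂ φ ]ˢ))
theorem5 n φ w = true⇒derivable , false⇒¬derivable
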